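{- Let $B$ be a positive integer (the bin capacity) and let $L=(a_1,\ldots,a_n)$ be any list of items with integer sizes $s(a_i)$, $1\le s(a_i)\le B$. Let $s(L)=\sum_{i=1}^n s(a_i)$, let $OPT(L)$ be the minimum number of bins of capacity $B$ into which the items of $L$ can be packed, and let $SS(L)$ be the number of bins used by the Sum of Squares algorithm on $L$. Then $$SS(L) ~<~ \frac{25}{9}\cdot\frac{s(L)}{B}+2 ~\le~ \frac{25}{9}\,OPT(L)+2.$$
   Context: Bin packing: a packing partitions the items into bins so that the total size of the items in each bin (the bin's level) is at most $B$. The Sum of Squares algorithm (SS) is an on-line algorithm that processes the items $a_1,\ldots,a_n$ in order, assigning each to a bin without knowledge of future items. For a current packing $P$ and $1\le h\le B-1$, let $n_h(P)$ be the number of bins of $P$ whose level equals $h$, and let $ss(P)=\sum_{h=1}^{B-1} n_h(P)^2$. When an item of size $s$ arrives, SS places it either into a new (empty) bin or into a partially filled bin of level at most $B-s$, choosing among these options one that minimizes $ss(P')$ for the resulting packing $P'$ (if several options attain the minimum, any of them may be chosen). $SS(L)$ is the total number of bins in the final packing. -}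

module Defs where

open import Data.Nat using (ℕ; zero; suc; _+_; _*_; _∸_; _^_; _≤_; _<_; _≟_)
open import Data.Fin as Fin using (Fin)
open import Data.List using (List; []; _∷_; length; map; filter; upTo)
open import Data.Nat.ListAction using (sum)
open import Data.Product using (Σ; _×_; _,_)
open import Data.Sum using (_⊎_)
open import Relation.Nullary using (yes; no)
open import Relation.Binary.PropositionalEquality using (_≡_)

-- A packing (state of the on-line algorithm) is the list of levels of its
-- (nonempty) bins; bin capacity B.

count : ℕ → List ℕ → ℕ
count h P = length (filter (λ x → x ≟ h) P)

ss : ℕ → List ℕ → ℕ
ss B P = sum (map (λ h → count h P ^ 2) (map suc (upTo (B ∸ 1))))

data PlaceExisting (B s : ℕ) : List ℕ → List ℕ → Set where
  here  : ∀ {h P} → h + s ≤ B → PlaceExisting B s (h ∷ P) (h + s ∷ P)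
  there : ∀ {h P P'} → PlaceExisting B s P P' → PlaceExisting B s (h ∷ P) (h ∷ P')

Option : ℕ → ℕ → List ℕ → List ℕ → Set
Option B s P P' = (P' ≡ s ∷ P) ⊎ PlaceExisting B s P P'

-- One SS step: an option minimizing ss of the resulting packing
-- (ties broken arbitrarily).
SSStep : ℕ → List ℕ → ℕ → List ℕ → Set
SSStep B P s P' = Option B s P P' × (∀ Q → Option B s P Q → ss B P' ≤ ss B Q)

data SSRun (B : ℕ) : List ℕ → List ℕ → List ℕ → Set where
  done : ∀ {P} → SSRun B P [] P
  step : ∀ {P P' a as Q} → SSStep B P a P' → SSRun B P' as Q → SSRun B P (a ∷ as) Q

-- Off-line packings: each item is assigned a bin in Fin k.
load : ∀ {k} → List ℕ → List (Fin k) → Fin k → ℕ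
load (a ∷ as) (j ∷ js) i with j Fin.≟ i
... | yes _ = a + load as js i
... | no _  = load as js i
load _ _ _ = 0

Feasible : ℕ → List ℕ → ℕ → Set
Feasible B L k = Σ (List (Fin k)) λ js → (length js ≡ length L) × (∀ i → load L js i ≤ B)

IsOPT : ℕ → List ℕ → ℕ → Set
IsOPT B L k = Feasible B L k × (∀ k' → Feasible B L k' → k ≤ k')

-- When SS opens a bin for an item of size s, minimality gives count h ≤ count (h + s) whenever
-- 1 ≤ h and h + s ≤ B: the counts ascend along the chains h, h + s, h + 2s, …, so the average level
-- is at least the worst average over a tail of a chain.  A new bin of level ≥ 9B/25 does no harm.
-- If s ≤ 8B/25, every such tail has mean ≥ 9B/25.  If 8B/25 < s < 9B/25, only chains starting
-- below B/25 can have a smaller mean.  But a bin below B/25 is opened only by an item s < B/25, and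
-- then a shift by a multiple of s shows that at least as many bins have level ≥ 23B/25, whose
-- surplus pays for those low bins.
module Submission where

open import Defs
open import Data.Nat using (ℕ; zero; suc; _+_; _*_; _∸_; _^_; _≤_; _<_; z≤n; s≤s; _≟_; _≤?_; _<?_; NonZero; pred; >-nonZero)
open import Data.Nat.Properties hiding (suc-injective)
open import Data.Nat.DivMod using (_/_; _%_; m≡m%n+[m/n]*n; m/n*n≤m; m%n<n; m<n⇒m/n≡0; m/n≡1+[m∸n]/n)
open import Data.Nat.ListAction using (sum)
open import Data.Nat.ListAction.Properties using (sum-↭)
open import Data.Nat.Tactic.RingSolver using (solve)
open import Data.Fin as Fin using (Fin)
open import Data.Fin.Properties using (suc-injective)
open import Data.List using (List; []; _∷_; [_]; _++_; length; map; filter; upTo; tabulate)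
open import Data.List.Properties using (map-id; filter-++; filter-accept; filter-reject; tabulate-cong; length-++; map-cong; map-++; upTo-∷ʳ)
open import Data.List.Membership.Propositional using (_∈_)
open import Data.List.Membership.Propositional.Properties using (∈-∃++)
open import Data.List.Relation.Unary.Any using (here; there)
open import Data.List.Relation.Unary.All as All using (All)
open import Data.List.Relation.Binary.Permutation.Propositional using (_↭_; prep; swap; ↭-refl; ↭-trans)
open import Data.List.Relation.Binary.Permutation.Propositional.Properties using (map⁺; filter-↭; ↭-length; shift)
open import Data.Product using (∃; ∃₂; _×_; _,_; proj₁; proj₂)
open import Data.Sum using (inj₁; inj₂)
open import Relation.Nullary using (yes; no; contradiction)
open import Relation.Binary.PropositionalEquality using (_≡_; _≢_; refl; sym; trans; cong; cong₂; subst; subst₂; module ≡-Reasoning)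

infixr 6 _⊕_

_⊕_ : ∀ {a b c d} → a ≤ b → c ≤ d → a + c ≤ b + d
_⊕_ = +-mono-≤

infix 7 _⊛_

_⊛_ : ∀ k {a b} → a ≤ b → k * a ≤ k * b
k ⊛ p = *-monoʳ-≤ k p

-- A Farkas certificate: A ≤ C is a combination of the hypotheses, k the slack.
linear : ∀ {a b A C} k → A ≤ C → a + C + k ≡ b + A → a ≤ b
linear {a} {b} {A} {C} k A≤C eq = +-cancelʳ-≤ A a b (begin
  a + A      ≤⟨ +-monoʳ-≤ a A≤C ⟩
  a + C      ≤⟨ m≤m+n (a + C) k ⟩
  a + C + k  ≡⟨ eq ⟩
  b + A      ∎)
  where open ≤-Reasoning

-- Multiplicities and weights of multisets of levels.

count-++ : ∀ h P Q → count h (P ++ Q) ≡ count h P + count h Q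
count-++ h P Q = trans (cong length (filter-++ (_≟ h) P Q)) (length-++ (filter (_≟ h) P))

count-∷ : ∀ h x P → count h (x ∷ P) ≡ count h [ x ] + count h P
count-∷ h x P = count-++ h [ x ] P

count-↭ : ∀ h {P Q} → P ↭ Q → count h P ≡ count h Q
count-↭ h p = ↭-length (filter-↭ (_≟ h) p)

count-≡ : ∀ h → count h [ h ] ≡ 1
count-≡ h = cong length (filter-accept (_≟ h) refl)

count-≢ : ∀ {h x} → x ≢ h → count h [ x ] ≡ 0
count-≢ {h} x≢h = cong length (filter-reject (_≟ h) x≢h)

count>0⇒∈ : ∀ {h} P → 1 ≤ count h P → h ∈ P
count>0⇒∈ {h} (x ∷ P) 1≤c with x ≟ h
... | yes refl = here refl
... | no x≢h = there (count>0⇒∈ P (subst (1 ≤_) (cong length (filter-reject (_≟ h) x≢h)) 1≤c))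

∈⇒↭ : ∀ {x : ℕ} {P} → x ∈ P → ∃ λ R → P ↭ x ∷ R
∈⇒↭ {x} x∈P with ∈-∃++ x∈P
... | ys , zs , refl = ys ++ zs , shift x ys zs

weight : (ℕ → ℕ) → List ℕ → ℕ
weight w P = sum (map w P)

weight-↭ : ∀ w {P Q} → P ↭ Q → weight w P ≡ weight w Q
weight-↭ w p = sum-↭ (map⁺ w p)

weight-+ : ∀ v w P → weight (λ x → v x + w x) P ≡ weight v P + weight w P
weight-+ v w [] = refl
weight-+ v w (x ∷ P) = trans (cong (v x + w x +_) (weight-+ v w P)) (interchange (v x) (w x) (weight v P) (weight w P))
  where
  interchange : ∀ a b c d → a + b + (c + d) ≡ a + c + (b + d)
  interchange a b c d = solve (a ∷ b ∷ c ∷ d ∷ [])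

weight-* : ∀ c w P → weight (λ x → c * w x) P ≡ c * weight w P
weight-* c w [] = sym (*-zeroʳ c)
weight-* c w (x ∷ P) = trans (cong (c * w x +_) (weight-* c w P)) (sym (*-distribˡ-+ c (w x) (weight w P)))

weight-const : ∀ c P → weight (λ _ → c) P ≡ c * length P
weight-const c [] = sym (*-zeroʳ c)
weight-const c (x ∷ P) = trans (cong (c +_) (weight-const c P)) (sym (*-suc c (length P)))

weight-mono : ∀ {v w P} → All (λ x → v x ≤ w x) P → weight v P ≤ weight w P
weight-mono All.[] = z≤n
weight-mono (p All.∷ ps) = +-mono-≤ p (weight-mono ps)

-- Multiplicity domination makes `Q` a sub-multiset of `P`: one copy of the head of `Q` is deleted
-- from both sides and the induction goes on. Whatever remains of `P` has nonnegative weight.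
weight-dominated : ∀ w Q P → (∀ {y} → y ∈ Q → count y Q ≤ count y P) → weight w Q ≤ weight w P
weight-dominated w [] P _ = z≤n
weight-dominated w (y ∷ Q) P Q≤P
  with R , P↭ ← ∈⇒↭ (count>0⇒∈ P (≤-trans
         (subst (1 ≤_) (sym (count-∷ y y Q)) (subst (λ c → 1 ≤ c + count y Q) (sym (count-≡ y)) (s≤s z≤n)))
         (Q≤P (here refl))))
  = begin
  w y + weight w Q  ≤⟨ +-monoʳ-≤ (w y) (weight-dominated w Q R Q≤R) ⟩
  w y + weight w R  ≡⟨ weight-↭ w P↭ ⟨
  weight w P        ∎
  where
  open ≤-Reasoning
  Q≤R : ∀ {z} → z ∈ Q → count z Q ≤ count z R
  Q≤R {z} z∈Q = +-cancelˡ-≤ (count z [ y ]) _ _ (begin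
    count z [ y ] + count z Q  ≡⟨ count-∷ z y Q ⟨
    count z (y ∷ Q)            ≤⟨ Q≤P (there z∈Q) ⟩
    count z P                  ≡⟨ count-↭ z P↭ ⟩
    count z (y ∷ R)            ≡⟨ count-∷ z y R ⟩
    count z [ y ] + count z R  ∎)

-- Ascending counts and summation along chains.

Ascending : ℕ → ℕ → List ℕ → Set
Ascending B d P = ∀ {h} → 1 ≤ h → h + d ≤ B → count h P ≤ count (h + d) P

ascending-multiple : ∀ {B d} P → Ascending B d P → ∀ j → Ascending B (j * d) P
ascending-multiple P asc zero {h} 1≤h _ rewrite +-identityʳ h = ≤-refl
ascending-multiple {B} {d} P asc (suc j) {h} 1≤h h+≤B =
  subst (λ x → count h P ≤ count x P) (+-assoc h d (j * d))
    (≤-trans (asc 1≤h (≤-trans (m≤m+n (h + d) (j * d)) le))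
             (ascending-multiple P asc j (≤-trans 1≤h (m≤m+n h d)) le))
  where
  le : h + d + j * d ≤ B
  le = subst (_≤ B) (sym (+-assoc h d (j * d))) h+≤B

-- A chain stops once it would exceed `B`; the default 0 is the value of the empty tail.
shifted : ℕ → ℕ → (ℕ → ℕ) → ℕ → ℕ
shifted B d w x with x + d ≤? B
... | yes _ = w (x + d)
... | no _ = 0

shifted-≤ : ∀ {B d} w {x} → x + d ≤ B → shifted B d w x ≡ w (x + d)
shifted-≤ {B} {d} w {x} le with x + d ≤? B
... | yes _ = refl
... | no ¬le = contradiction le ¬le

raised : ℕ → ℕ → List ℕ → List ℕ
raised B d [] = []
raised B d (x ∷ P) with x + d ≤? B
... | yes _ = x + d ∷ raised B d P
... | no _ = raised B d P

∈-raised⁻ : ∀ {B d y} P → y ∈ raised B d P → ∃ λ x → x ∈ P × y ≡ x + d × x + d ≤ B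
∈-raised⁻ {B} {d} (x ∷ P) y∈ with x + d ≤? B
∈-raised⁻ (x ∷ P) (here refl) | yes le = x , here refl , refl , le
∈-raised⁻ (x ∷ P) (there y∈) | yes _ with ∈-raised⁻ P y∈
... | z , z∈ , eq , le = z , there z∈ , eq , le
∈-raised⁻ (x ∷ P) y∈ | no _ with ∈-raised⁻ P y∈
... | z , z∈ , eq , le = z , there z∈ , eq , le

weight-raised : ∀ B d w P → weight w (raised B d P) ≡ weight (shifted B d w) P
weight-raised B d w [] = refl
weight-raised B d w (x ∷ P) with x + d ≤? B
... | yes _ = cong (w (x + d) +_) (weight-raised B d w P)
... | no _ = weight-raised B d w P

-- An inequality, because when `x + d` exceeds `B` the copies of `x` are dropped; otherwise adding
-- `d` is injective and nothing else lands on `x + d`.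
count-raised : ∀ B d x P → count (x + d) (raised B d P) ≤ count x P
count-raised B d x [] = z≤n
count-raised B d x (y ∷ P) with y + d ≤? B
... | no _ = ≤-trans (count-raised B d x P) (≤-trans (m≤n+m _ (count x [ y ])) (≤-reflexive (sym (count-∷ x y P))))
... | yes _ = subst₂ _≤_ (sym (count-∷ (x + d) (y + d) (raised B d P))) (sym (count-∷ x y P))
  (+-mono-≤ (≤-reflexive singleton) (count-raised B d x P))
  where
  singleton : count (x + d) [ y + d ] ≡ count x [ y ]
  singleton with y ≟ x
  ... | yes refl = trans (count-≡ (x + d)) (sym (count-≡ x))
  ... | no y≢x = trans (count-≢ (λ eq → y≢x (+-cancelʳ-≡ d y x eq))) (sym (count-≢ y≢x))

-- Moving every bin up by `d` and dropping those that overflow gives a multiset dominated by `P`: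
-- the copies of `x + d` come from the copies of `x`, and by ascent `P` has at least that many at
-- `x + d`.
weight-shifted : ∀ {B d P} w → All (1 ≤_) P → Ascending B d P → weight (shifted B d w) P ≤ weight w P
weight-shifted {B} {d} {P} w pos asc =
  subst (_≤ weight w P) (weight-raised B d w P) (weight-dominated w (raised B d P) P dom)
  where
  dom : ∀ {y} → y ∈ raised B d P → count y (raised B d P) ≤ count y P
  dom y∈ with ∈-raised⁻ P y∈
  ... | x , x∈P , refl , le = ≤-trans (count-raised B d x P) (asc (All.lookup pos x∈P) le)

-- Summation by parts along the chains x, x + d, x + 2d, …: w bounds the tail sums of c ∸ e from below.
weight-telescope : ∀ {B d P} c e w → All (1 ≤_) P → Ascending B d P →
  All (λ x → e x + w x ≤ c x + shifted B d w x) P → weight e P ≤ weight c P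
weight-telescope {B} {d} {P} c e w pos asc tail = +-cancelʳ-≤ (weight w P) _ _ (begin
  weight e P + weight w P                        ≡⟨ weight-+ e w P ⟨
  weight (λ x → e x + w x) P                     ≤⟨ weight-mono tail ⟩
  weight (λ x → c x + shifted B d w x) P         ≡⟨ weight-+ c (shifted B d w) P ⟩
  weight c P + weight (shifted B d w) P          ≤⟨ +-monoʳ-≤ (weight c P) (weight-shifted w pos asc) ⟩
  weight c P + weight w P                        ∎)
  where open ≤-Reasoning

-- The change of the sum of squares, and ascent when a bin is opened.

squares : List ℕ → List ℕ → ℕ
squares hs P = sum (map (λ h → count h P ^ 2) hs)

-- A count `c` raised by one adds `2 * c + 1` to its square. The factor `count x hs` lets the
-- induction run over arbitrary `hs`; for `range` it is 1 or 0.
squares-∷ : ∀ hs x P → squares hs (x ∷ P) ≡ squares hs P + count x hs * (2 * count x P + 1)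
squares-∷ [] x P = refl
squares-∷ (h ∷ hs) x P = begin
  count h (x ∷ P) ^ 2 + squares hs (x ∷ P)
    ≡⟨ cong₂ _+_ square (squares-∷ hs x P) ⟩
  count h P ^ 2 + count x [ h ] * m + (squares hs P + count x hs * m)
    ≡⟨ regroup (count h P ^ 2) (squares hs P) (count x [ h ]) (count x hs) m ⟩
  count h P ^ 2 + squares hs P + (count x [ h ] + count x hs) * m
    ≡⟨ cong (λ k → count h P ^ 2 + squares hs P + k * m) (count-∷ x h hs) ⟨
  count h P ^ 2 + squares hs P + count x (h ∷ hs) * m ∎
  where
  open ≡-Reasoning
  m = 2 * count x P + 1
  regroup : ∀ a b k l m → a + k * m + (b + l * m) ≡ a + b + (k + l) * m
  regroup a b k l m = solve (a ∷ b ∷ k ∷ l ∷ m ∷ [])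
  increment : ∀ {n c k} → n ≡ suc c → k ≡ 1 → n ^ 2 ≡ c ^ 2 + k * (2 * c + 1)
  increment {c = c} refl refl = expand c
    where
    expand : ∀ c → suc c * (suc c * 1) ≡ c * (c * 1) + 1 * (2 * c + 1)
    expand c = solve (c ∷ [])
  unchanged : ∀ {n c k} m → n ≡ c → k ≡ 0 → n ^ 2 ≡ c ^ 2 + k * m
  unchanged {c = c} m refl refl = sym (+-identityʳ (c ^ 2))
  square : count h (x ∷ P) ^ 2 ≡ count h P ^ 2 + count x [ h ] * (2 * count x P + 1)
  square with h ≟ x
  ... | yes refl = increment (trans (count-∷ h h P) (cong (_+ count h P) (count-≡ h))) (count-≡ h)
  ... | no h≢x = unchanged _ (trans (count-∷ h x P) (cong (_+ count h P) (count-≢ (λ eq → h≢x (sym eq))))) (count-≢ h≢x)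

range : ℕ → List ℕ
range n = map suc (upTo n)

count-range-suc : ∀ x n → count x (range (suc n)) ≡ count x (range n) + count x [ suc n ]
count-range-suc x n = begin
  count x (map suc (upTo (suc n)))   ≡⟨ cong (λ hs → count x (map suc hs)) (upTo-∷ʳ n) ⟨
  count x (map suc (upTo n ++ [ n ]))  ≡⟨ cong (count x) (map-++ suc (upTo n) [ n ]) ⟩
  count x (range n ++ [ suc n ])     ≡⟨ count-++ x (range n) [ suc n ] ⟩
  count x (range n) + count x [ suc n ] ∎
  where open ≡-Reasoning

count-range-out : ∀ {x} n → n < x → count x (range n) ≡ 0
count-range-out zero _ = refl
count-range-out {x} (suc n) n<x = trans (count-range-suc x n)
  (cong₂ _+_ (count-range-out n (<-trans (n<1+n n) n<x)) (count-≢ (<⇒≢ n<x)))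

count-range-in : ∀ {x} n → 1 ≤ x → x ≤ n → count x (range n) ≡ 1
count-range-in zero (s≤s _) ()
count-range-in {x} (suc n) 1≤x x≤ with x ≟ suc n
... | yes refl = trans (count-range-suc x n) (cong₂ _+_ (count-range-out n ≤-refl) (count-≡ x))
... | no x≢ = trans (count-range-suc x n)
  (cong₂ _+_ (count-range-in n 1≤x (≤-pred (≤∧≢⇒< x≤ x≢))) (count-≢ (λ eq → x≢ (sym eq))))

ss-↭ : ∀ B {P Q} → P ↭ Q → ss B P ≡ ss B Q
ss-↭ B p = cong sum (map-cong (λ h → cong (_^ 2) (count-↭ h p)) (range (B ∸ 1)))

ss-∷-partial : ∀ {B x} P → 1 ≤ x → x < B → ss B (x ∷ P) ≡ ss B P + (2 * count x P + 1)
ss-∷-partial {suc B} {x} P 1≤x (s≤s x≤B) = trans (squares-∷ (range B) x P)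
  (cong (ss (suc B) P +_) (trans (cong (_* (2 * count x P + 1)) (count-range-in B 1≤x x≤B)) (*-identityˡ _)))

ss-∷-full : ∀ {B} P → 1 ≤ B → ss B (B ∷ P) ≡ ss B P
ss-∷-full {suc B} P _ = trans (squares-∷ (range B) (suc B) P)
  (trans (cong (λ c → ss (suc B) P + c * (2 * count (suc B) P + 1)) (count-range-out B ≤-refl)) (+-identityʳ _))

-- `R` collects the bins that are not touched. Describing the packing before and after as `R` plus
-- one bin reduces the comparison of their `ss` to single insertions.
place : ∀ {B s h P} → h ∈ P → h + s ≤ B → ∃₂ λ R Q → P ↭ h ∷ R × Q ↭ h + s ∷ R × PlaceExisting B s P Q
place {s = s} {h} {P = _ ∷ P} (here refl) le = P , h + s ∷ P , ↭-refl , ↭-refl , here le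
place {s = s} {h} {P = x ∷ P} (there h∈P) le with place h∈P le
... | R , Q , P↭ , Q↭ , pl =
  x ∷ R , x ∷ Q , ↭-trans (prep x P↭) (swap x h ↭-refl) , ↭-trans (prep x Q↭) (swap x (h + s) ↭-refl) , there pl

-- If some bin has level `h`, the new bin is compared with the rival option of adding the item to
-- that bin. With `R` the other bins, minimality bounds the squares lost at `h` by those gained at
-- `h + s`.
new-bin⇒ascending : ∀ {B s P} → 1 ≤ s → (∀ Q → Option B s P Q → ss B (s ∷ P) ≤ ss B Q) → Ascending B s P
new-bin⇒ascending {B} {s} {P} 1≤s best {h} 1≤h le with count h P in eq
... | zero = z≤n
... | suc c with place {s = s} (count>0⇒∈ P (subst (1 ≤_) (sym eq) (s≤s z≤n))) le
...   | R , Q , P↭ , Q↭ , pl = subst₂ _≤_ (trans (sym countP) eq) (sym countP+) main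
  where
  open ≤-Reasoning
  h<B : h < B
  h<B = <-≤-trans (m<m+n h 1≤s) le
  s<B : s < B
  s<B = <-≤-trans (m<n+m s 1≤h) le
  countP : count h P ≡ suc (count h R)
  countP = trans (count-↭ h P↭) (trans (count-∷ h h R) (cong (_+ count h R) (count-≡ h)))
  countP+ : count (h + s) P ≡ count (h + s) R
  countP+ = trans (count-↭ (h + s) P↭) (trans (count-∷ (h + s) h R)
    (cong (_+ count (h + s) R) (count-≢ (<⇒≢ (m<m+n h 1≤s)))))
  compare : ss B R + (2 * count h R + 1) + (2 * count s P + 1) ≤ ss B (h + s ∷ R)
  compare = begin
    ss B R + (2 * count h R + 1) + (2 * count s P + 1)  ≡⟨ cong (_+ (2 * count s P + 1)) (ss-∷-partial R 1≤h h<B) ⟨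
    ss B (h ∷ R) + (2 * count s P + 1)                  ≡⟨ cong (_+ (2 * count s P + 1)) (ss-↭ B P↭) ⟨
    ss B P + (2 * count s P + 1)                        ≡⟨ ss-∷-partial P 1≤s s<B ⟨
    ss B (s ∷ P)                                        ≤⟨ best Q (inj₂ pl) ⟩
    ss B Q                                              ≡⟨ ss-↭ B Q↭ ⟩
    ss B (h + s ∷ R)                                    ∎
  main : suc (count h R) ≤ count (h + s) R
  main with h + s ≟ B
  -- Filling a bin exactly removes it from `ss`, so this option would be strictly better than the
  -- new bin: no such `h` can occur.
  ... | yes refl = contradiction (≤-trans compare (≤-reflexive (ss-∷-full R (≤-trans 1≤h (<⇒≤ h<B)))))
    (<⇒≱ (<-≤-trans (m<m+n (ss B R) (m≤n+m 1 (2 * count h R))) (m≤m+n _ (2 * count s P + 1))))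
  -- The new bin costs at least 1, so twice the count of `h` in `R` lies strictly below twice the
  -- count of `h + s`; strictness makes up for the bin missing from `R`.
  ... | no h+s≢B = *-cancelˡ-< 2 _ _ (cancel (ss B R) (count h R) (count s P) (count (h + s) R)
      (≤-trans compare (≤-reflexive (ss-∷-partial R (≤-trans 1≤h (m≤m+n h s)) (≤∧≢⇒< le h+s≢B)))))
    where
    cancel : ∀ r a b c → r + (2 * a + 1) + (2 * b + 1) ≤ r + (2 * c + 1) → 1 + 2 * a ≤ 2 * c
    cancel r a b c p = linear (2 * b) p (solve (r ∷ a ∷ b ∷ c ∷ []))

-- Bins below B/25 matched with bins of level at least 23B/25.

low high : ℕ → ℕ → ℕ
low B x with 25 * x <? B
... | yes _ = 1
... | no _ = 0
high B x with 23 * B ≤? 25 * x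
... | yes _ = 1
... | no _ = 0

low-yes : ∀ {B x} → 25 * x < B → low B x ≡ 1
low-yes {B} {x} p with 25 * x <? B
... | yes _ = refl
... | no ¬p = contradiction p ¬p

low-no : ∀ {B x} → B ≤ 25 * x → low B x ≡ 0
low-no {B} {x} p with 25 * x <? B
... | yes q = contradiction p (<⇒≱ q)
... | no _ = refl

high-yes : ∀ {B x} → 23 * B ≤ 25 * x → high B x ≡ 1
high-yes {B} {x} p with 23 * B ≤? 25 * x
... | yes _ = refl
... | no ¬p = contradiction p ¬p

high-no : ∀ {B x} → 25 * x < 23 * B → high B x ≡ 0
high-no {B} {x} p with 23 * B ≤? 25 * x
... | yes q = contradiction q (<⇒≱ p)
... | no _ = refl

low-antitone : ∀ B {x y} → x ≤ y → low B y ≤ low B x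
low-antitone B {x} {y} x≤y with 25 * y <? B
... | no _ = z≤n
... | yes q = ≤-reflexive (sym (low-yes (≤-<-trans (*-monoʳ-≤ 25 x≤y) q)))

high-monotone : ∀ B {x y} → x ≤ y → high B x ≤ high B y
high-monotone B {x} {y} x≤y with 23 * B ≤? 25 * x
... | no _ = z≤n
... | yes q = ≤-reflexive (sym (high-yes (≤-trans q (*-monoʳ-≤ 25 x≤y))))

-- The window from 23B/25 to 24B/25 is longer than `s`, so the largest multiple of `s` not above its
-- right end lies inside.
multiple-near : ∀ B s → 1 ≤ s → 25 * s < B → ∃ λ j → 23 * B ≤ 25 * (j * s) × 25 * (j * s) ≤ 24 * B
multiple-near B s@(suc _) _ 25s<B = j , lower , upper
  where
  j = (24 * B) / (25 * s)
  swap-factors : ∀ j s → j * (25 * s) ≡ 25 * (j * s)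
  swap-factors j s = solve (j ∷ s ∷ [])
  upper : 25 * (j * s) ≤ 24 * B
  upper = subst (_≤ 24 * B) (swap-factors j s) (m/n*n≤m (24 * B) (25 * s))
  remainder : 24 * B ≤ B + 25 * (j * s)
  remainder = begin
    24 * B                                         ≡⟨ m≡m%n+[m/n]*n (24 * B) (25 * s) ⟩
    (24 * B) % (25 * s) + j * (25 * s)             ≤⟨ +-mono-≤ (<⇒≤ (<-trans (m%n<n (24 * B) (25 * s)) 25s<B)) (≤-reflexive (swap-factors j s)) ⟩
    B + 25 * (j * s)                               ∎
    where open ≤-Reasoning
  lower : 23 * B ≤ 25 * (j * s)
  lower = +-cancelˡ-≤ B _ _ remainder

-- Shifting by the multiple of `s` from `multiple-near` sends each low level to a high one, and
-- counts ascend along this shift too.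
low≤high : ∀ {B s P} → 1 ≤ s → 25 * s < B → All (1 ≤_) P → Ascending B s P →
  weight (low B) P ≤ weight (high B) P
low≤high {B} {s} {P} 1≤s 25s<B pos asc with multiple-near B s 1≤s 25s<B
... | j , lower , upper =
  ≤-trans (weight-mono (All.universal raise P)) (weight-shifted (high B) pos (ascending-multiple P asc j))
  where
  raise : ∀ x → low B x ≤ shifted B (j * s) (high B) x
  raise x with 25 * x <? B
  ... | no _ = z≤n
  ... | yes 25x<B = ≤-reflexive (sym (trans (shifted-≤ {B} {j * s} (high B) {x} fits) (high-yes (≤-trans lower (*-monoʳ-≤ 25 (m≤n+m (j * s) x))))))
    where
    -- The right end 24B/25 of the window leaves room for a level below B/25.
    fits : x + j * s ≤ B
    fits = *-cancelˡ-≤ 25 (subst₂ _≤_ (sym (*-distribˡ-+ 25 x (j * s))) refl (<⇒≤ 25x<B ⊕ upper))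

weight-linear : ∀ c P → weight (c *_) P ≡ c * sum P
weight-linear c P = trans (weight-* c (λ x → x) P) (cong (λ Q → c * sum Q) (map-id P))

-- Density when the item opening a bin has size at most 8B/25.

module SmallItem {B s : ℕ} .{{_ : NonZero s}} (25s≤8B : 25 * s ≤ 8 * B) where

  steps : ℕ → ℕ
  steps x = (B ∸ x) / s

  -- The chain x, x + s, …, x + k s has mean x + k s / 2; this is 50 times its total excess over 9B/25.
  chain : ℕ → ℕ
  chain x = suc (steps x) * (50 * x + 25 * (steps x * s) ∸ 18 * B)

  steps-upper : ∀ {x} → x ≤ B → B ≤ x + (steps x * s + s)
  steps-upper {x} x≤B = begin
    B                                         ≡⟨ m+[n∸m]≡n x≤B ⟨
    x + (B ∸ x)                               ≡⟨ cong (x +_) (m≡m%n+[m/n]*n (B ∸ x) s) ⟩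
    x + ((B ∸ x) % s + steps x * s)           ≤⟨ +-monoʳ-≤ x (+-monoˡ-≤ _ (<⇒≤ (m%n<n (B ∸ x) s))) ⟩
    x + (s + steps x * s)                     ≡⟨ cong (x +_) (+-comm s _) ⟩
    x + (steps x * s + s)                     ∎
    where open ≤-Reasoning

  -- A chain with last step `k` cannot start below `B` minus `k + 1` steps. For `k` at most 2 this
  -- and the bound on `s` suffice.
  mean-≥ : ∀ x k → B ≤ x + (k * s + s) → 18 * B ≤ 50 * x + 25 * (k * s)
  mean-≥ x 0 p = linear (16 * B) (50 ⊛ p ⊕ 2 ⊛ 25s≤8B) (solve (B ∷ x ∷ s ∷ []))
  mean-≥ x 1 p = linear (8 * B) (50 ⊛ p ⊕ 3 ⊛ 25s≤8B) (solve (B ∷ x ∷ s ∷ []))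
  -- The tight case, which fixes the thresholds: levels B/25, 9B/25, 17B/25 have mean exactly 9B/25.
  mean-≥ x 2 p = linear 0 (50 ⊛ p ⊕ 4 ⊛ 25s≤8B) (solve (B ∷ x ∷ s ∷ []))
  -- From three steps on, 18 times the number of steps plus one is at most 25 times the number of
  -- steps, so `p` alone is enough.
  mean-≥ x (suc (suc (suc k))) p = linear (32 * x + 7 * (k * s) + 3 * s) (18 ⊛ p) (solve (B ∷ x ∷ s ∷ k ∷ []))

  -- The excess of a chain is that of its first level plus that of the rest. By `mean-≥` the
  -- truncated subtraction is exact here.
  chain-tail : ∀ {x} → x ≤ B → 18 * B + chain x ≤ 50 * x + shifted B s chain x
  chain-tail {x} x≤B with x + s ≤? B
  ... | no x+s≰B = ≤-reflexive (trans
    (cong (λ k → 18 * B + suc k * (50 * x + 25 * (k * s) ∸ 18 * B)) k≡0)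
    (trans (cong (18 * B +_) (*-identityˡ (50 * x + 0 ∸ 18 * B))) (m+[n∸m]≡n (mean-≥ x 0 (subst (λ k → B ≤ x + (k * s + s)) k≡0 (steps-upper x≤B))))))
    where
    k≡0 : steps x ≡ 0
    k≡0 = m<n⇒m/n≡0 (+-cancelˡ-< x _ _ (subst (_< x + s) (sym (m+[n∸m]≡n x≤B)) (≰⇒> x+s≰B)))
  -- Here `e` is the mean excess times 50; removing the first level raises the mean by half of `s`,
  -- hence `e` by `25 * s`.
  ... | yes x+s≤B = ≤-reflexive (begin
    18 * B + chain x
      ≡⟨ cong (λ k → 18 * B + suc k * (50 * x + 25 * (k * s) ∸ 18 * B)) k≡ ⟩
    18 * B + suc (suc k′) * e
      ≡⟨ regroup (18 * B) k′ e ⟩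
    18 * B + e + suc k′ * e
      ≡⟨ cong (_+ suc k′ * e) (m+[n∸m]≡n 18B≤A) ⟩
    A + suc k′ * e
      ≡⟨ regroup′ x s k′ e ⟩
    50 * x + suc k′ * (e + 25 * s)
      ≡⟨ cong (λ z → 50 * x + suc k′ * z) (+-∸-comm (25 * s) 18B≤A) ⟨
    50 * x + suc k′ * (A + 25 * s ∸ 18 * B)
      ≡⟨ cong (λ z → 50 * x + suc k′ * (z ∸ 18 * B)) (advance x s k′) ⟨
    50 * x + chain (x + s) ∎)
    where
    open ≡-Reasoning
    k′ = steps (x + s)
    A = 50 * x + 25 * (suc k′ * s)
    e = A ∸ 18 * B
    k≡ : steps x ≡ suc k′
    k≡ = trans (m/n≡1+[m∸n]/n (+-cancelˡ-≤ x _ _ (subst (x + s ≤_) (sym (m+[n∸m]≡n x≤B)) x+s≤B)))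
           (cong (λ z → suc (z / s)) (∸-+-assoc B x s))
    18B≤A : 18 * B ≤ A
    18B≤A = mean-≥ x (suc k′) (subst (λ k → B ≤ x + (k * s + s)) k≡ (steps-upper x≤B))
    regroup : ∀ b k e → b + suc (suc k) * e ≡ b + e + suc k * e
    regroup b k e = solve (b ∷ k ∷ e ∷ [])
    regroup′ : ∀ x s k e → 50 * x + 25 * (suc k * s) + suc k * e ≡ 50 * x + suc k * (e + 25 * s)
    regroup′ x s k e = solve (x ∷ s ∷ k ∷ e ∷ [])
    advance : ∀ x s k → 50 * (x + s) + 25 * (k * s) ≡ 50 * x + 25 * (suc k * s) + 25 * s
    advance x s k = solve (x ∷ s ∷ k ∷ [])

  density : ∀ {P} → All (λ x → 1 ≤ x × x ≤ B) P → Ascending B s P → 9 * B * length P ≤ 25 * sum P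
  density {P} levels asc = *-cancelˡ-≤ 2 (subst₂ _≤_
    (trans (weight-const (18 * B) P) (double B (length P)))
    (trans (weight-linear 50 P) (*-assoc 2 25 (sum P)))
    (weight-telescope (50 *_) (λ _ → 18 * B) chain (All.map proj₁ levels) asc (All.map (λ l → chain-tail (proj₂ l)) levels)))
    where
    double : ∀ b l → 18 * b * l ≡ 2 * (9 * b * l)
    double b l = solve (b ∷ l ∷ [])

-- Density when the item opening a bin has size between 8B/25 and 9B/25.

module MediumItem {B s : ℕ} (8B≤25s : 8 * B ≤ 25 * s) (25s≤9B : 25 * s ≤ 9 * B) where

  -- What a bin of level at least 9B/25 can pass to lower levels of its chain; a high bin first sets
  -- aside another `9 * B` for a low bin.
  surplus : ℕ → ℕ
  surplus x = 25 * x ∸ (9 * B + 9 * B * high B x)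

  surplus-high : ∀ {x} → 23 * B ≤ 25 * x → surplus x + 18 * B ≡ 25 * x
  surplus-high {x} p = trans (cong (λ z → 25 * x ∸ (9 * B + 9 * B * z) + 18 * B) (high-yes p))
    (trans (cong (λ z → 25 * x ∸ z + 18 * B) (double B)) (m∸n+n≡m (≤-trans (*-monoˡ-≤ B (m≤m+n 18 5)) p)))
    where
    double : ∀ b → 9 * b + 9 * b * 1 ≡ 18 * b
    double b = solve (b ∷ [])

  surplus-low : ∀ {x} → 25 * x < 23 * B → 9 * B ≤ 25 * x → surplus x + 9 * B ≡ 25 * x
  surplus-low {x} p q = trans (cong (λ z → 25 * x ∸ (9 * B + 9 * B * z) + 9 * B) (high-no p))
    (trans (cong (λ z → 25 * x ∸ z + 9 * B) (trivial B)) (m∸n+n≡m q))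
    where
    trivial : ∀ b → 9 * b + 9 * b * 0 ≡ 9 * b
    trivial b = solve (b ∷ [])

  surplus-total : ∀ {x} → 9 * B ≤ 25 * x → 9 * B + 9 * B * high B x + surplus x ≡ 25 * x
  surplus-total {x} q with ≤-<-connex (23 * B) (25 * x)
  ... | inj₁ p = trans (cong (λ z → 9 * B + 9 * B * z + surplus x) (high-yes p))
    (trans (rearrange B (surplus x)) (surplus-high p))
    where
    rearrange : ∀ b w → 9 * b + 9 * b * 1 + w ≡ w + 18 * b
    rearrange b w = solve (b ∷ w ∷ [])
  ... | inj₂ p = trans (cong (λ z → 9 * B + 9 * B * z + surplus x) (high-no p))
    (trans (rearrange B (surplus x)) (surplus-low p q))
    where
    rearrange : ∀ b w → 9 * b + 9 * b * 0 + w ≡ w + 9 * b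
    rearrange b w = solve (b ∷ w ∷ [])

  -- A lower bound for the surplus of a tail. From 9B/25 on, two terms are kept, as a third level
  -- would already be at least `B`. Below 9B/25 the tail is left free to be spent entirely, hence 0.
  chain : ℕ → ℕ
  chain x with 9 * B ≤? 25 * x
  ... | yes _ = surplus x + shifted B s surplus x
  ... | no _ = 0

  chain-≥ : ∀ {x} → 9 * B ≤ 25 * x → chain x ≡ surplus x + shifted B s surplus x
  chain-≥ {x} p with 9 * B ≤? 25 * x
  ... | yes _ = refl
  ... | no ¬p = contradiction p ¬p

  chain-< : ∀ {x} → 25 * x < 9 * B → chain x ≡ 0
  chain-< {x} p with 9 * B ≤? 25 * x
  ... | yes q = contradiction q (<⇒≱ p)
  ... | no _ = refl

  -- The extra terms move `9 * B` from each high bin to each low bin.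
  cost gain : ℕ → ℕ
  cost x = 9 * B + 9 * B * high B x
  gain x = 25 * x + 9 * B * low B x

  shifted-surplus≤chain : ∀ {x} → 9 * B ≤ 25 * x → shifted B s surplus x ≤ shifted B s chain x
  shifted-surplus≤chain {x} p with x + s ≤? B
  ... | no _ = z≤n
  ... | yes _ = ≤-trans (m≤m+n _ (shifted B s surplus (x + s)))
    (≤-reflexive (sym (chain-≥ (≤-trans p (25 ⊛ m≤m+n x s)))))

  -- The deficit at `x` is paid by the levels `x + s` and `x + s + s`. The first is at least 9B/25
  -- but never high; the cases are whether the second exceeds `B`, is high, or is neither.
  9B≤chain : ∀ {x} → B ≤ 25 * x → 25 * x < 9 * B → 9 * B ≤ 25 * x + chain (x + s)
  9B≤chain {x} B≤25x 25x<9B = subst (λ z → 9 * B ≤ 25 * x + z) (sym (chain-≥ 9B≤25y)) pay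
    where
    y = x + s
    9B≤25y : 9 * B ≤ 25 * (x + s)
    9B≤25y = linear 0 (B≤25x ⊕ 8B≤25s) (solve (B ∷ x ∷ s ∷ []))
    25y<23B : 25 * (x + s) < 23 * B
    25y<23B = linear (5 * B) (25x<9B ⊕ 25s≤9B) (solve (B ∷ x ∷ s ∷ []))
    surplus-y : 25 * y ≤ surplus y + 9 * B
    surplus-y = ≤-reflexive (sym (surplus-low 25y<23B 9B≤25y))
    last : ∀ u → 25 * (x + s) ≤ u + 9 * B → B ≤ x + s + s → 9 * B ≤ 25 * x + (u + 0)
    last u p q = linear (5 * B) (p ⊕ 50 ⊛ q ⊕ 3 ⊛ 25s≤9B) (solve (B ∷ x ∷ s ∷ u ∷ []))
    -- Tight again: the three levels average `x + s`, which is at least 9B/25.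
    next-low : ∀ u v → 25 * (x + s) ≤ u + 9 * B → 25 * (x + s + s) ≤ v + 9 * B → 9 * B ≤ 25 * x + (u + v)
    next-low u v p q = linear 0 (p ⊕ q ⊕ 3 ⊛ B≤25x ⊕ 3 ⊛ 8B≤25s) (solve (B ∷ x ∷ s ∷ u ∷ v ∷ []))
    -- The reserve of the high bin is covered because a high third level forces `x + s` up to at
    -- least 14B/25.
    next-high : ∀ u v → 25 * (x + s) ≤ u + 9 * B → 25 * (x + s + s) ≤ v + 18 * B → 23 * B ≤ 25 * (x + s + s) →
      9 * B ≤ 25 * x + (u + v)
    next-high u v p q r = linear (6 * B) (p ⊕ q ⊕ 3 ⊛ r ⊕ 3 ⊛ 25s≤9B) (solve (B ∷ x ∷ s ∷ u ∷ v ∷ []))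
    pay : 9 * B ≤ 25 * x + (surplus y + shifted B s surplus y)
    pay with y + s ≤? B
    ... | no y+s≰B = last (surplus y) surplus-y (<⇒≤ (≰⇒> y+s≰B))
    ... | yes _ with ≤-<-connex (23 * B) (25 * (y + s))
    ...   | inj₁ p = next-high (surplus y) (surplus (y + s)) surplus-y (≤-reflexive (sym (surplus-high p))) p
    ...   | inj₂ p = next-low (surplus y) (surplus (y + s)) surplus-y
              (≤-reflexive (sym (surplus-low p (≤-trans 9B≤25y (25 ⊛ m≤m+n y s)))))

  cost-chain-< : ∀ {x} → 25 * x < 9 * B → cost x + chain x ≡ 9 * B
  cost-chain-< {x} p = trans (cong₂ (λ h c → 9 * B + 9 * B * h + c) (high-no (<-≤-trans p (*-monoˡ-≤ B (m≤m+n 9 14)))) (chain-< p))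
    (trivial B)
    where
    trivial : ∀ b → 9 * b + 9 * b * 0 + 0 ≡ 9 * b
    trivial b = solve (b ∷ [])

  -- Levels from 9B/25 on pay for themselves, levels from B/25 to 9B/25 are paid by their tail, and
  -- lower ones by the transfer from high bins.
  chain-tail : ∀ x → cost x + chain x ≤ gain x + shifted B s chain x
  chain-tail x with ≤-<-connex (9 * B) (25 * x)
  ... | inj₁ 9B≤25x = begin
    cost x + chain x                                ≡⟨ cong (cost x +_) (chain-≥ 9B≤25x) ⟩
    cost x + (surplus x + shifted B s surplus x)    ≡⟨ +-assoc (cost x) _ _ ⟨
    cost x + surplus x + shifted B s surplus x      ≡⟨ cong (_+ shifted B s surplus x) (surplus-total 9B≤25x) ⟩
    25 * x + shifted B s surplus x                  ≤⟨ m≤m+n (25 * x) (9 * B * low B x) ⊕ shifted-surplus≤chain {x} 9B≤25x ⟩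
    gain x + shifted B s chain x                    ∎
    where open ≤-Reasoning
  ... | inj₂ 25x<9B with ≤-<-connex B (25 * x)
  ...   | inj₁ B≤25x = begin
    cost x + chain x                ≡⟨ cost-chain-< 25x<9B ⟩
    9 * B                           ≤⟨ 9B≤chain {x} B≤25x 25x<9B ⟩
    25 * x + chain (x + s)          ≡⟨ cong (25 * x +_) (shifted-≤ {B} {s} chain {x} x+s≤B) ⟨
    25 * x + shifted B s chain x    ≤⟨ +-monoˡ-≤ _ (m≤m+n (25 * x) (9 * B * low B x)) ⟩
    gain x + shifted B s chain x    ∎
    where
    open ≤-Reasoning
    x+s≤B : x + s ≤ B
    x+s≤B = *-cancelˡ-≤ 25 (linear (7 * B) (<⇒≤ 25x<9B ⊕ 25s≤9B) (solve (B ∷ x ∷ s ∷ [])))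
  ...   | inj₂ 25x<B = begin
    cost x + chain x                ≡⟨ cost-chain-< 25x<9B ⟩
    9 * B                           ≡⟨ *-identityʳ (9 * B) ⟨
    9 * B * 1                       ≡⟨ cong (9 * B *_) (low-yes 25x<B) ⟨
    9 * B * low B x                 ≤⟨ m≤n+m _ (25 * x) ⟩
    gain x                          ≤⟨ m≤m+n (gain x) _ ⟩
    gain x + shifted B s chain x    ∎
    where open ≤-Reasoning

  -- Telescoping leaves `9 * B` charged per high bin and credited per low bin. These cancel up to
  -- the one low bin that may be unmatched, which is the final `9 * B`.
  density : ∀ {P} → All (1 ≤_) P → Ascending B s P → weight (low B) P ≤ suc (weight (high B) P) →
    9 * B * length P ≤ 25 * sum P + 9 * B
  density {P} pos asc balanced = +-cancelʳ-≤ (9 * B * weight (high B) P) _ _ (begin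
    9 * B * length P + 9 * B * weight (high B) P
      ≡⟨ cong₂ _+_ (weight-const (9 * B) P) (weight-* (9 * B) (high B) P) ⟨
    weight (λ _ → 9 * B) P + weight (λ x → 9 * B * high B x) P
      ≡⟨ weight-+ (λ _ → 9 * B) (λ x → 9 * B * high B x) P ⟨
    weight cost P
      ≤⟨ weight-telescope gain cost chain pos asc (All.universal chain-tail P) ⟩
    weight gain P
      ≡⟨ weight-+ (25 *_) (λ x → 9 * B * low B x) P ⟩
    weight (25 *_) P + weight (λ x → 9 * B * low B x) P
      ≡⟨ cong₂ _+_ (weight-linear 25 P) (weight-* (9 * B) (low B) P) ⟩
    25 * sum P + 9 * B * weight (low B) P
      ≤⟨ +-monoʳ-≤ (25 * sum P) (*-monoʳ-≤ (9 * B) balanced) ⟩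
    25 * sum P + 9 * B * suc (weight (high B) P)
      ≡⟨ cong (25 * sum P +_) (*-suc (9 * B) (weight (high B) P)) ⟩
    25 * sum P + (9 * B + 9 * B * weight (high B) P)
      ≡⟨ +-assoc (25 * sum P) (9 * B) _ ⟨
    25 * sum P + 9 * B + 9 * B * weight (high B) P ∎)
    where open ≤-Reasoning

-- The invariant of a run.

record Invariant (B : ℕ) (P : List ℕ) : Set where
  field
    levels   : All (λ x → 1 ≤ x × x ≤ B) P
    -- The 1 is for a low bin that has just been opened. Later placements only raise levels, so they
    -- create no low bin and destroy no high one.
    balanced : weight (low B) P ≤ suc (weight (high B) P)
    -- The constant 10 is 9 for an unmatched low bin, plus 9 for a new bin, minus 8 for the item
    -- that opens it.
    dense    : 9 * B * length P ≤ 25 * sum P + 10 * B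

place-levels : ∀ {B s P P′} → PlaceExisting B s P P′ → All (λ x → 1 ≤ x × x ≤ B) P → All (λ x → 1 ≤ x × x ≤ B) P′
place-levels {s = s} (here {h} le) ((1≤h , _) All.∷ ls) = (≤-trans 1≤h (m≤m+n h s) , le) All.∷ ls
place-levels (there pl) (l All.∷ ls) = l All.∷ place-levels pl ls

place-length : ∀ {B s P P′} → PlaceExisting B s P P′ → length P′ ≡ length P
place-length (here _) = refl
place-length (there pl) = cong suc (place-length pl)

place-sum : ∀ {B s P P′} → PlaceExisting B s P P′ → sum P′ ≡ s + sum P
place-sum {s = s} {h ∷ P} (here _) = trans (cong (_+ sum P) (+-comm h s)) (+-assoc s h (sum P))
place-sum {s = s} {h ∷ P} (there pl) = trans (cong (h +_) (place-sum pl)) (left-comm h s (sum P))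
  where
  left-comm : ∀ a b c → a + (b + c) ≡ b + (a + c)
  left-comm a b c = solve (a ∷ b ∷ c ∷ [])

place-low : ∀ {B s P P′} → PlaceExisting B s P P′ → weight (low B) P′ ≤ weight (low B) P
place-low {B} {s} (here {h} _) = +-monoˡ-≤ _ (low-antitone B (m≤m+n h s))
place-low {B} (there {h} pl) = +-monoʳ-≤ (low B h) (place-low pl)

place-high : ∀ {B s P P′} → PlaceExisting B s P P′ → weight (high B) P ≤ weight (high B) P′
place-high {B} {s} (here {h} _) = +-monoˡ-≤ _ (high-monotone B (m≤m+n h s))
place-high {B} (there {h} pl) = +-monoʳ-≤ (high B h) (place-high pl)

option-sum : ∀ {B s P P′} → Option B s P P′ → sum P′ ≡ s + sum P
option-sum (inj₁ refl) = refl
option-sum (inj₂ pl) = place-sum pl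

-- A new low bin makes the counts ascend with a step below B/25, so `low≤high` restores full balance
-- just before it is added; the error does not accumulate.
new-balanced : ∀ {B s P} → 1 ≤ s → Ascending B s P → Invariant B P →
  weight (low B) (s ∷ P) ≤ suc (weight (high B) (s ∷ P))
new-balanced {B} {s} {P} 1≤s asc inv with ≤-<-connex B (25 * s)
... | inj₁ B≤25s = begin
  low B s + weight (low B) P              ≡⟨ cong (_+ weight (low B) P) (low-no B≤25s) ⟩
  weight (low B) P                        ≤⟨ Invariant.balanced inv ⟩
  suc (weight (high B) P)                 ≤⟨ s≤s (m≤n+m _ (high B s)) ⟩
  suc (high B s + weight (high B) P)      ∎
  where open ≤-Reasoning
... | inj₂ 25s<B = begin
  low B s + weight (low B) P              ≡⟨ cong (_+ weight (low B) P) (low-yes 25s<B) ⟩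
  suc (weight (low B) P)                  ≤⟨ s≤s (low≤high 1≤s 25s<B (All.map proj₁ (Invariant.levels inv)) asc) ⟩
  suc (weight (high B) P)                 ≤⟨ s≤s (m≤n+m _ (high B s)) ⟩
  suc (high B s + weight (high B) P)      ∎
  where open ≤-Reasoning

-- Only an item of size at least 9B/25 builds on the earlier bound, and it pays for its own bin.
-- Otherwise ascent gives the density of `P` afresh.
new-dense : ∀ {B s P} → 1 ≤ s → Ascending B s P → Invariant B P →
  9 * B * length (s ∷ P) ≤ 25 * sum (s ∷ P) + 10 * B
new-dense {B} {s@(suc _)} {P} 1≤s asc inv with ≤-<-connex (25 * s) (8 * B) | ≤-<-connex (9 * B) (25 * s)
... | inj₁ 25s≤8B | _ = bound B s (length P) (sum P) (SmallItem.density 25s≤8B (Invariant.levels inv) asc)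
  where
  bound : ∀ b s l σ → 9 * b * l ≤ 25 * σ → 9 * b * suc l ≤ 25 * (s + σ) + 10 * b
  bound b s l σ p = linear (b + 25 * s) p (solve (b ∷ s ∷ l ∷ σ ∷ []))
... | inj₂ _ | inj₁ 9B≤25s = bound B s (length P) (sum P) 9B≤25s (Invariant.dense inv)
  where
  bound : ∀ b s l σ → 9 * b ≤ 25 * s → 9 * b * l ≤ 25 * σ + 10 * b → 9 * b * suc l ≤ 25 * (s + σ) + 10 * b
  bound b s l σ p q = linear 0 (p ⊕ q) (solve (b ∷ s ∷ l ∷ σ ∷ []))
... | inj₂ 8B<25s | inj₂ 25s<9B = bound B s (length P) (sum P) (<⇒≤ 8B<25s)
    (MediumItem.density (<⇒≤ 8B<25s) (<⇒≤ 25s<9B) (All.map proj₁ (Invariant.levels inv)) asc (Invariant.balanced inv))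
  where
  bound : ∀ b s l σ → 8 * b ≤ 25 * s → 9 * b * l ≤ 25 * σ + 9 * b → 9 * b * suc l ≤ 25 * (s + σ) + 10 * b
  bound b s l σ p q = linear 0 (p ⊕ q) (solve (b ∷ s ∷ l ∷ σ ∷ []))

step-invariant : ∀ {B s P P′} → 1 ≤ s → s ≤ B → SSStep B P s P′ → Invariant B P → Invariant B P′
step-invariant 1≤s s≤B (inj₁ refl , best) inv = record
  { levels   = (1≤s , s≤B) All.∷ Invariant.levels inv
  ; balanced = new-balanced 1≤s asc inv
  ; dense    = new-dense 1≤s asc inv
  }
  where
  asc = new-bin⇒ascending 1≤s best
step-invariant {B} {s} {P} {P′} 1≤s s≤B (inj₂ pl , _) inv = record
  { levels   = place-levels pl (Invariant.levels inv)
  ; balanced = ≤-trans (place-low pl) (≤-trans (Invariant.balanced inv) (s≤s (place-high pl)))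
  ; dense    = begin
      9 * B * length P′           ≡⟨ cong (9 * B *_) (place-length pl) ⟩
      9 * B * length P            ≤⟨ Invariant.dense inv ⟩
      25 * sum P + 10 * B         ≤⟨ +-monoˡ-≤ (10 * B) (25 ⊛ m≤n+m (sum P) s) ⟩
      25 * (s + sum P) + 10 * B   ≡⟨ cong (λ z → 25 * z + 10 * B) (place-sum pl) ⟨
      25 * sum P′ + 10 * B        ∎
  }
  where open ≤-Reasoning

run-invariant : ∀ {B L P Q} → All (λ a → 1 ≤ a × a ≤ B) L → SSRun B P L Q → Invariant B P →
  Invariant B Q × sum Q ≡ sum P + sum L
run-invariant All.[] (done {P}) inv = inv , sym (+-identityʳ (sum P))
run-invariant ((1≤a , a≤B) All.∷ sizes) (step {P} {P′} {a} {as} {Q} st run) inv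
  with run-invariant sizes run (step-invariant 1≤a a≤B st inv)
... | inv′ , total = inv′ , (begin
  sum Q                     ≡⟨ total ⟩
  sum P′ + sum as           ≡⟨ cong (_+ sum as) (option-sum (proj₁ st)) ⟩
  a + sum P + sum as        ≡⟨ cong (_+ sum as) (+-comm a (sum P)) ⟩
  sum P + a + sum as        ≡⟨ +-assoc (sum P) a (sum as) ⟩
  sum P + (a + sum as)      ∎)
  where open ≡-Reasoning

-- The total size as a lower bound for off-line packings.

sum-tabulate-bump : ∀ {k} (j : Fin k) {a f g} → g j ≡ a + f j → (∀ i → j ≢ i → g i ≡ f i) →
  sum (tabulate g) ≡ a + sum (tabulate f)
sum-tabulate-bump Fin.zero {a} {f} at off = trans
  (cong₂ _+_ at (cong sum (tabulate-cong (λ i → off (Fin.suc i) λ ()))))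
  (+-assoc a (f Fin.zero) _)
sum-tabulate-bump (Fin.suc j) {a} {f} {g} at off = trans
  (cong₂ _+_ (off Fin.zero λ ()) (sum-tabulate-bump j at (λ i j≢i → off (Fin.suc i) (λ eq → j≢i (suc-injective eq)))))
  (left-comm (f Fin.zero) a _)
  where
  left-comm : ∀ a b c → a + (b + c) ≡ b + (a + c)
  left-comm a b c = solve (a ∷ b ∷ c ∷ [])

sum-tabulate-≤ : ∀ {k b} {f : Fin k → ℕ} → (∀ i → f i ≤ b) → sum (tabulate f) ≤ b * k
sum-tabulate-≤ {zero} f≤ = z≤n
sum-tabulate-≤ {suc k} {b} {f} f≤ = begin
  f Fin.zero + sum (tabulate (λ i → f (Fin.suc i)))  ≤⟨ f≤ Fin.zero ⊕ sum-tabulate-≤ (λ i → f≤ (Fin.suc i)) ⟩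
  b + b * k                                          ≡⟨ *-suc b k ⟨
  b * suc k                                          ∎
  where open ≤-Reasoning

-- Each item changes exactly one load, by its size.
sum-loads : ∀ {k} L (js : List (Fin k)) → length js ≡ length L → sum (tabulate (load L js)) ≡ sum L
-- All loads are 0, so the bound with `b` equal to 0 forces the sum to be 0.
sum-loads {k} [] [] _ = n≤0⇒n≡0 (sum-tabulate-≤ {k} {0} (λ _ → z≤n))
sum-loads (a ∷ L) (j ∷ js) eq =
  trans (sum-tabulate-bump j load-at load-off) (cong (a +_) (sum-loads L js (cong pred eq)))
  where
  load-at : load (a ∷ L) (j ∷ js) j ≡ a + load L js j
  load-at with j Fin.≟ j
  ... | yes _ = refl
  ... | no j≢j = contradiction refl j≢j
  load-off : ∀ i → j ≢ i → load (a ∷ L) (j ∷ js) i ≡ load L js i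
  load-off i j≢i with j Fin.≟ i
  ... | yes j≡i = contradiction j≡i j≢i
  ... | no _ = refl

feasible⇒sum≤ : ∀ {B L k} → Feasible B L k → sum L ≤ B * k
feasible⇒sum≤ {B} {L} {k} (js , len , fits) = subst (_≤ B * k) (sum-loads L js len) (sum-tabulate-≤ fits)

theorem1 : (B : ℕ) → 1 ≤ B → (L : List ℕ) → All (λ a → (1 ≤ a) × (a ≤ B)) L →
    (P : List ℕ) → SSRun B [] L P → (k : ℕ) → IsOPT B L k →
    (9 * B * length P < 25 * sum L + 18 * B) × (25 * sum L + 18 * B ≤ 25 * B * k + 18 * B)
theorem1 B 1≤B L sizes P run k (feasible , _)
  with inv , total ← run-invariant sizes run (record
         { levels = All.[] ; balanced = z≤n ; dense = ≤-trans (≤-reflexive (*-zeroʳ (9 * B))) z≤n })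
  = upper , +-monoˡ-≤ (18 * B) (≤-trans (25 ⊛ feasible⇒sum≤ {B} {L} feasible) (≤-reflexive (sym (*-assoc 25 B k))))
  where
  open ≤-Reasoning
  upper : 9 * B * length P < 25 * sum L + 18 * B
  upper = begin-strict
    9 * B * length P        ≤⟨ Invariant.dense inv ⟩
    25 * sum P + 10 * B     ≡⟨ cong (λ z → 25 * z + 10 * B) total ⟩
    -- After scaling by `9 * B`, the additive 2 is `18 * B`. The inequality is strict as `B` is
    -- positive.
    25 * sum L + 10 * B     <⟨ +-monoʳ-< (25 * sum L) (*-monoˡ-< B {{>-nonZero 1≤B}} (m≤m+n 11 7)) ⟩
    25 * sum L + 18 * B     ∎
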